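{- Let $G$ be a graph on $n$ vertices of diameter at most $3$. Then $c(G)<n^{\frac{4}{7}+o(1)}$, where $o(1)$ denotes a quantity tending to $0$ as $n\to\infty$.
   Context: Cops and Robbers on a graph $G$: first each of $k$ cops chooses an initial vertex, then the robber chooses an initial vertex. Then the players alternate, starting with the cops: in a cops' turn every cop either stays at its vertex or moves to an adjacent vertex, and in the robber's turn the robber stays or moves to an adjacent vertex. Several cops may occupy the same vertex, and both players have full information. The cops win if, whatever the robber does, after some cops' move some cop occupies the robber's vertex. The cop number $c(G)$ is the least $k$ for which the cops win. -}

module Defs where

open import Data.Nat using (ℕ; zero; suc)
open import Data.Fin using (Fin)
open import Data.Bool using (Bool; true; false; T)
open import Data.Product using (Σ; _×_; Σ-syntax)
open import Data.Sum using (_⊎_)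
open import Relation.Binary.PropositionalEquality using (_≡_)

record Graph (n : ℕ) : Set where
  field
    edge  : Fin n → Fin n → Bool
    sym   : ∀ u v → edge u v ≡ edge v u
    irrefl : ∀ u → edge u u ≡ false

module _ {n : ℕ} (G : Graph n) where
  open Graph G

  Adj : Fin n → Fin n → Set
  Adj u v = T (edge u v)

  Step : Fin n → Fin n → Set
  Step u v = u ≡ v ⊎ Adj u v

  Within : ℕ → Fin n → Fin n → Set
  Within zero    u v = u ≡ v
  Within (suc m) u v = u ≡ v ⊎ Σ[ w ∈ Fin n ] (Adj u w × Within m w v)

  DiamAtMost : ℕ → Set
  DiamAtMost d = ∀ u v → Within d u v

  -- CopWinFrom C r : position with cops at C, robber at r, cops to move,
  -- from which the cops can force a capture in finitely many rounds.
  data CopWinFrom {k : ℕ} : (Fin k → Fin n) → Fin n → Set where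
    win : ∀ {C r} (C' : Fin k → Fin n) →
          (∀ i → Step (C i) (C' i)) →
          (Σ[ i ∈ Fin k ] (C' i ≡ r)) ⊎ (∀ r' → Step r r' → CopWinFrom C' r') →
          CopWinFrom C r

  CopsWin : ℕ → Set
  CopsWin k = Σ[ C ∈ (Fin k → Fin n) ] (∀ r → CopWinFrom C r)

{-# OPTIONS --safe #-}
-- Let x = ⌊n^(1/7)⌋. Greedily station about x⁴ sentries so that every vertex has at most x³ closed
-- neighbours in the unguarded region R. A set C of about x⁴ log n further cops is chosen so that,
-- from a robber at r, a greedy matching of N[r] ∩ R to C (at distance ≤ 2, hence two moves) catches
-- the robber's next step unless it goes to an unmatched vertex. All members of C within distance 2
-- of the unmatched set E(r) are used by the matching, so there are at most x³ of them, and the choice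
-- of C forces |N₂(E(r))| = O(x⁶). So O(x⁴) guards suffice to leave a residual part of N₂(E(r)) in
-- which every vertex has at most x² closed neighbours; as the diameter is 3, these guards are in
-- place after three moves. Playing this from the robber's positions r₀ and r₁ leaves at most x²
-- choices for each of r₃ and r₄ once r₂ is known, so x⁴ cops sent out at that time occupy all
-- candidates for r₄ just in time.
module Submission where

open import Defs
open import Data.Nat using (ℕ; _≤_; _<_; _^_; _*_; _+_)
open import Data.Product using (_×_; ∃-syntax)
open import Data.Nat using (zero; suc; z≤n; s≤s; s≤s⁻¹; _∸_; NonZero; >-nonZero; >-nonZero⁻¹; _≤?_)
open import Data.Nat.Properties hiding (_≟_)
open import Data.Nat.DivMod using (_/_; _%_; m/n*n≤m; m*n/n≡m; /-monoˡ-≤; m≡m%n+[m/n]*n; m%n<n)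
open import Data.Nat.Tactic.RingSolver using (solve-∀)
open import Algebra.Properties.CommutativeSemigroup *-commutativeSemigroup using (interchange)
  renaming (x∙yz≈y∙xz to *-swap)
open import Algebra.Properties.CommutativeSemigroup +-commutativeSemigroup using ()
  renaming (x∙yz≈y∙xz to +-swap)
open import Data.Bool using (T)
open import Data.Bool.Properties using (T?)
open import Data.Fin using (Fin; zero; suc; combine; remQuot)
open import Data.Fin.Patterns using (0F; 1F; 2F; 3F; 4F; 5F)
open import Data.Fin.Properties using (_≟_; remQuot-combine) renaming (any? to anyFin?)
open import Data.List using
  (List; []; _∷_; _++_; length; map; filter; allFin; tabulate; concatMap; cartesianProductWith; cartesianProduct)
open import Data.Nat.ListAction using (sum)
open import Data.List.Properties using (length-++; length-map; length-tabulate; length-filter)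
open import Data.List.Membership.Propositional using (_∈_; _∉_; lose; find)
open import Data.List.Membership.Propositional.Properties using
  (∈-filter⁺; ∈-filter⁻; ∈-allFin; ∈-cartesianProduct⁺; ∈-cartesianProductWith⁺; ∈-++⁺ˡ; ∈-++⁺ʳ; ∈-concatMap⁺)
open import Data.List.Relation.Unary.Any using (Any; here; there; any?)
open import Data.Product using (_,_; proj₁; proj₂; uncurry)
open import Data.Sum using (_⊎_; inj₁; inj₂; [_,_]′)
open import Function using (_∘_; id)
open import Relation.Binary.PropositionalEquality using (_≡_; refl; sym; trans; cong; cong₂; subst)
open import Relation.Nullary using (Dec; yes; no; contradiction; ¬?; _×-dec_; _⊎-dec_)
open import Relation.Unary using (Pred; Decidable)
open import Level using (0ℓ)

private variable
  A B : Set

-- Counting in lists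

length-filter-split : {P : Pred A 0ℓ} (P? : Decidable P) (xs : List A) →
  length (filter P? xs) + length (filter (¬? ∘ P?) xs) ≡ length xs
length-filter-split P? [] = refl
length-filter-split P? (x ∷ xs) with P? x
... | yes _ = cong suc (length-filter-split P? xs)
... | no  _ = trans (+-suc _ _) (cong suc (length-filter-split P? xs))

length-concatMap-≤ : (f : A → List B) (c : ℕ) → (∀ a → length (f a) ≤ c) →
  (xs : List A) → length (concatMap f xs) ≤ length xs * c
length-concatMap-≤ f c h [] = z≤n
length-concatMap-≤ f c h (x ∷ xs) = ≤-trans (≤-reflexive (length-++ (f x)))
  (+-mono-≤ (h x) (length-concatMap-≤ f c h xs))

length-cartesianProductWith : {C : Set} (f : A → B → C) (xs : List A) (ys : List B) →
  length (cartesianProductWith f xs ys) ≡ length xs * length ys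
length-cartesianProductWith f [] ys = refl
length-cartesianProductWith f (x ∷ xs) ys = trans (length-++ (map (f x) ys))
  (cong₂ _+_ (length-map (f x) ys) (length-cartesianProductWith f xs ys))

length-allFin : ∀ n → length (allFin n) ≡ n
length-allFin n = length-tabulate {n = n} id

lists : List A → ℕ → List (List A)
lists as zero    = [] ∷ []
lists as (suc m) = [] ∷ cartesianProductWith _∷_ as (lists as m)

∈-lists : {as : List A} → (∀ a → a ∈ as) → ∀ m xs → length xs ≤ m → xs ∈ lists as m
∈-lists all zero    []       _       = here refl
∈-lists all (suc m) []       _       = here refl
∈-lists all (suc m) (x ∷ xs) (s≤s h) =
  there (∈-cartesianProductWith⁺ _∷_ (all x) (∈-lists all m xs h))

-- Padding with a blank turns a list of length at most `m` into a word of length `m` over an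
-- alphabet with one extra letter.
length-lists : (as : List A) (m : ℕ) → length (lists as m) ≤ suc (length as) ^ m
length-lists as zero    = ≤-refl
length-lists as (suc m) = begin
  suc (length (cartesianProductWith _∷_ as (lists as m)))
    ≡⟨ cong suc (length-cartesianProductWith _∷_ as (lists as m)) ⟩
  suc (length as * length (lists as m))
    ≤⟨ +-mono-≤ (m^n>0 (suc (length as)) m) (*-monoʳ-≤ (length as) (length-lists as m)) ⟩
  suc (length as) ^ m + length as * suc (length as) ^ m ∎
  where open ≤-Reasoning

-- Gives a team of fixed size `K` the posts in a list; surplus cops stand at the default `v`.
slot : {K : ℕ} → A → List A → Fin K → A
slot v []       _       = v
slot v (x ∷ xs) zero    = x
slot v (x ∷ xs) (suc i) = slot v xs i

∈-slot : {K : ℕ} (v : A) {xs : List A} {x : A} → x ∈ xs → length xs ≤ K →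
  ∃[ i ] (slot {K = K} v xs i ≡ x)
∈-slot v (here refl) (s≤s h) = zero , refl
∈-slot v (there p)   (s≤s h) = let i , eq = ∈-slot v p h in suc i , eq

-- Double counting and greedy hitting sets

module _ {H : A → B → Set} (H? : ∀ a b → Dec (H a b)) where

  double-count : (as : List A) (bs : List B) →
    sum (map (λ a → length (filter (H? a) bs)) as) ≡
    sum (map (λ b → length (filter (λ a → H? a b) as)) bs)
  double-count [] bs = sym (zeros bs)
    where
    zeros : (bs : List B) → sum (map (λ b → 0) bs) ≡ 0
    zeros []       = refl
    zeros (_ ∷ bs) = zeros bs
  double-count (a ∷ as) bs = trans (cong (_ +_) (double-count as bs)) (row bs)
    where
    hits : A → List B → ℕ
    hits a bs = length (filter (H? a) bs)
    hitters : B → ℕ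
    hitters b = length (filter (λ a → H? a b) as)
    total : List B → ℕ
    total bs = sum (map hitters bs)
    row : (bs : List B) → hits a bs + total bs ≡
      sum (map (λ b → length (filter (λ a → H? a b) (a ∷ as))) bs)
    row [] = refl
    row (b ∷ bs) with H? a b
    ... | yes _ = cong suc (trans (+-swap (hits a bs) (hitters b) (total bs)) (cong (hitters b +_) (row bs)))
    ... | no  _ = trans (+-swap (hits a bs) (hitters b) (total bs)) (cong (hitters b +_) (row bs))

sum-map-≥ : (f : A → ℕ) (s : ℕ) (xs : List A) → (∀ {x} → x ∈ xs → s ≤ f x) →
  length xs * s ≤ sum (map f xs)
sum-map-≥ f s []       h = z≤n
sum-map-≥ f s (x ∷ xs) h = +-mono-≤ (h (here refl)) (sum-map-≥ f s xs (h ∘ there))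

average : (f : A → ℕ) (x : A) (xs : List A) → ∃[ y ] (sum (map f (x ∷ xs)) ≤ suc (length xs) * f y)
average f x []       = x , ≤-refl
average f x (w ∷ ws) with average f w ws
... | y , h with ≤-total (f x) (f y)
...   | inj₁ x≤y = y , +-mono-≤ x≤y h
...   | inj₂ y≤x = x , +-monoʳ-≤ (f x) (≤-trans h (*-monoʳ-≤ (suc (length ws)) y≤x))

module _ {n : ℕ} {H : A → Fin (suc n) → Set} (H? : ∀ a v → Dec (H a v)) where

  -- Some point hits at least the average fraction s / (s + t) of I; removing the members it hits
  -- scales |I| by t / (s + t).
  hitting-set : ∀ s t → s + t ≡ suc n → ∀ j (I : List A) →
    (∀ {a} → a ∈ I → s ≤ length (filter (H? a) (allFin (suc n)))) →
    length I * t ^ j < suc n ^ j →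
    ∃[ C ] (length C ≤ j × (∀ {a} → a ∈ I → ∃[ v ] (v ∈ C × H a v)))
  hitting-set s t eq zero [] big few = [] , z≤n , λ ()
  -- With no picks left, `few` says that `I` has less than one member.
  hitting-set s t eq zero (_ ∷ I) big few = contradiction few (<⇒≱ (s≤s (s≤s z≤n)))
  hitting-set s t eq (suc j) I big few = v ∷ C , s≤s C≤j , hits
    where
    hit : Fin (suc n) → List A
    hit v = filter (λ a → H? a v) I
    avg : ∃[ v ] (sum (map (length ∘ hit) (allFin (suc n))) ≤ length (allFin (suc n)) * length (hit v))
    avg = average (length ∘ hit) zero (tabulate suc)
    v : Fin (suc n)
    v = proj₁ avg
    I' : List A
    I' = filter (λ a → ¬? (H? a v)) I
    open ≤-Reasoning
    v-hits : length I * s ≤ suc n * length (hit v)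
    v-hits = begin
      length I * s ≤⟨ sum-map-≥ _ s I big ⟩
      sum (map (λ a → length (filter (H? a) (allFin (suc n)))) I)
        ≡⟨ double-count H? I (allFin (suc n)) ⟩
      sum (map (length ∘ hit) (allFin (suc n))) ≤⟨ proj₂ avg ⟩
      length (allFin (suc n)) * length (hit v) ≡⟨ cong (_* length (hit v)) (length-allFin (suc n)) ⟩
      suc n * length (hit v) ∎
    shrink : suc n * length I' ≤ length I * t
    shrink = +-cancelˡ-≤ (length I * s) _ _ (begin
      length I * s + suc n * length I'               ≤⟨ +-monoˡ-≤ _ v-hits ⟩
      suc n * length (hit v) + suc n * length I'     ≡⟨ *-distribˡ-+ (suc n) (length (hit v)) (length I') ⟨
      suc n * (length (hit v) + length I')
        ≡⟨ cong (suc n *_) (length-filter-split (λ a → H? a v) I) ⟩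
      suc n * length I                               ≡⟨ *-comm (suc n) _ ⟩
      length I * suc n                               ≡⟨ cong (length I *_) eq ⟨
      length I * (s + t)                             ≡⟨ *-distribˡ-+ (length I) s t ⟩
      length I * s + length I * t                    ∎)
    few' : length I' * t ^ j < suc n ^ j
    few' = *-cancelˡ-< (suc n) _ _ (begin-strict
      suc n * (length I' * t ^ j)  ≡⟨ *-assoc (suc n) (length I') (t ^ j) ⟨
      suc n * length I' * t ^ j    ≤⟨ *-monoˡ-≤ (t ^ j) shrink ⟩
      length I * t * t ^ j         ≡⟨ *-assoc (length I) t _ ⟩
      length I * t ^ suc j         <⟨ few ⟩
      suc n ^ suc j                ∎)
    rec = hitting-set s t eq j I' (big ∘ proj₁ ∘ ∈-filter⁻ _) few'
    C = proj₁ rec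
    C≤j = proj₁ (proj₂ rec)
    hits : ∀ {a} → a ∈ I → ∃[ w ] (w ∈ v ∷ C × H a w)
    hits {a} a∈I with H? a v
    ... | yes p = v , here refl , p
    ... | no ¬p = let w , w∈C , p = proj₂ (proj₂ rec) (∈-filter⁺ _ a∈I ¬p) in w , there w∈C , p

-- Decay of the part not yet hit

-- Bernoulli's inequality for `(1 + s/t)^g`, cleared of denominators. The induction drops the
-- second-order term `t ^ g * (s * (g * s))`.
bernoulli : ∀ s t g → t ^ g * (t + g * s) ≤ t * (s + t) ^ g
bernoulli s t zero    = ≤-reflexive (base t)
  where
  base : ∀ t → 1 * (t + 0) ≡ t * 1
  base = solve-∀
bernoulli s t (suc g) = begin
  t * t ^ g * (t + (s + g * s))           ≤⟨ m≤m+n _ _ ⟩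
  t * t ^ g * (t + (s + g * s)) + t ^ g * (s * (g * s)) ≡⟨ lemma s t g (t ^ g) ⟩
  (s + t) * (t ^ g * (t + g * s))         ≤⟨ *-monoʳ-≤ (s + t) (bernoulli s t g) ⟩
  (s + t) * (t * (s + t) ^ g)             ≡⟨ *-swap (s + t) t _ ⟩
  t * ((s + t) * (s + t) ^ g)             ∎
  where
  open ≤-Reasoning
  lemma : ∀ s t g p → t * p * (t + (s + g * s)) + p * (s * (g * s)) ≡ (s + t) * (p * (t + g * s))
  lemma = solve-∀

-- As `t ≤ s + t ≤ g * s`, the factor `t + g * s` in `bernoulli` is at least `2 * t`. Cancelling `t`
-- forces the separate case `t = 0`.
halving : ∀ s t g → 1 ≤ s → s + t ≤ g * s → 2 * t ^ g ≤ (s + t) ^ g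
halving s zero zero 1≤s h = contradiction (≤-trans 1≤s (≤-trans (m≤m+n s 0) h)) λ ()
halving s zero (suc g) 1≤s h = z≤n
halving s t@(suc _) g 1≤s h = *-cancelˡ-≤ t (begin
  t * (2 * t ^ g)      ≡⟨ lemma t (t ^ g) ⟩
  t ^ g * (t + t)      ≤⟨ *-monoʳ-≤ (t ^ g) (+-monoʳ-≤ t (≤-trans (m≤n+m t s) h)) ⟩
  t ^ g * (t + g * s)  ≤⟨ bernoulli s t g ⟩
  t * (s + t) ^ g      ∎)
  where
  open ≤-Reasoning
  lemma : ∀ t p → t * (2 * p) ≡ p * (t + t)
  lemma = solve-∀

^-distribʳ-* : ∀ x y b → (x * y) ^ b ≡ x ^ b * y ^ b
^-distribʳ-* x y zero    = refl
^-distribʳ-* x y (suc b) = trans (cong (x * y *_) (^-distribʳ-* x y b)) (interchange x y _ _)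

-- Supplies the size hypothesis of `hitting-set` for `g * b` picks: each batch of `g` picks halves
-- what remains, and `b` batches exhaust fewer than `2 ^ b` members.
decay : ∀ s t g b I → 1 ≤ s → s + t ≤ g * s → I < 2 ^ b → I * t ^ (g * b) < (s + t) ^ (g * b)
decay s t g b I 1≤s h I<2^b with t ^ (g * b) in eq
-- Multiplying by zero would lose the strictness of `I < 2 ^ b`.
... | zero  = subst (_< (s + t) ^ (g * b)) (sym (*-zeroʳ I))
                (m^n>0 (s + t) {{>-nonZero (≤-trans 1≤s (m≤m+n s t))}} (g * b))
... | suc p = begin-strict
  I * suc p              <⟨ *-monoˡ-< (suc p) I<2^b ⟩
  2 ^ b * suc p          ≡⟨ cong (2 ^ b *_) (trans (sym eq) (sym (^-*-assoc t g b))) ⟩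
  2 ^ b * (t ^ g) ^ b    ≡⟨ ^-distribʳ-* 2 (t ^ g) b ⟨
  (2 * t ^ g) ^ b        ≤⟨ ^-monoˡ-≤ b (halving s t g 1≤s h) ⟩
  ((s + t) ^ g) ^ b      ≡⟨ ^-*-assoc (s + t) g b ⟩
  (s + t) ^ (g * b)      ∎
  where
  open ≤-Reasoning

-- Greedy domination

-- While some `v` sees at least `D` remaining elements, it is picked and they are removed, so each
-- pick pays for `D` elements of `Y`. This yields the sentries as well as the guards.
dominate : ∀ {n} {S : Fin n → A → Set} (S? : ∀ v a → Dec (S v a)) (D : ℕ) → 1 ≤ D →
  ∀ fuel Y → length Y ≤ fuel →
  ∃[ Q ] ∃[ Z ] (length Q * D ≤ length Y
    × (∀ {y} → y ∈ Y → y ∈ Z ⊎ ∃[ q ] (q ∈ Q × S q y))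
    × (∀ v → length (filter (S? v) Z) ≤ D))
dominate S? D 1≤D fuel Y Y≤ with anyFin? (λ v → D ≤? length (filter (S? v) Y))
... | no ¬rich = [] , Y , z≤n , inj₁ , λ v → ≰⇒≥ (λ h → ¬rich (v , h))
dominate S? D 1≤D zero [] Y≤ | yes (v , rich) = contradiction (≤-trans 1≤D rich) λ ()
dominate S? D 1≤D (suc fuel) Y Y≤ | yes (v , rich) = v ∷ Q , Z , size , cover , proj₂ (proj₂ (proj₂ (proj₂ rec)))
  where
  open ≤-Reasoning
  Y' = filter (λ y → ¬? (S? v y)) Y
  split : length (filter (S? v) Y) + length Y' ≡ length Y
  split = length-filter-split (S? v) Y
  rec = dominate S? D 1≤D fuel Y' (s≤s⁻¹ (≤-trans
    (≤-trans (+-monoˡ-≤ (length Y') (≤-trans 1≤D rich)) (≤-reflexive split)) Y≤))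
  Q = proj₁ rec
  Z = proj₁ (proj₂ rec)
  size : D + length Q * D ≤ length Y
  size = ≤-trans (+-mono-≤ rich (proj₁ (proj₂ (proj₂ rec)))) (≤-reflexive split)
  cover : ∀ {y} → y ∈ Y → y ∈ Z ⊎ ∃[ q ] (q ∈ v ∷ Q × _)
  cover {y} y∈Y with S? v y
  ... | yes p = inj₂ (v , here refl , p)
  ... | no ¬p with proj₁ (proj₂ (proj₂ (proj₂ rec))) (∈-filter⁺ _ y∈Y ¬p)
  ...   | inj₁ y∈Z = inj₁ y∈Z
  ...   | inj₂ (q , q∈Q , p) = inj₂ (q , there q∈Q , p)

-- Steps, distances and matchings

module Play {n : ℕ} (G : Graph n) where
  open Graph G using (edge)

  V : Set
  V = Fin n

  Step? : ∀ u v → Dec (Step G u v)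
  Step? u v = u ≟ v ⊎-dec T? (edge u v)

  step-sym : ∀ {u v} → Step G u v → Step G v u
  step-sym (inj₁ refl) = inj₁ refl
  step-sym {u} {v} (inj₂ e) = inj₂ (subst T (Graph.sym G u v) e)

  -- Distance at most 2, with a midpoint where a cop can stand between its two moves.
  Near : V → V → Set
  Near u v = ∃[ w ] (Step G u w × Step G w v)

  Near? : ∀ u v → Dec (Near u v)
  Near? u v = anyFin? (λ w → Step? u w ×-dec Step? w v)

  near-refl : ∀ {v} → Near v v
  near-refl {v} = v , inj₁ refl , inj₁ refl

  -- Shorter walks are padded with pauses, so that a whole team arrives after exactly three moves.
  three-steps : ∀ {u v} → Within G 3 u v → ∃[ w ] ∃[ w' ] (Step G u w × Step G w w' × Step G w' v)
  three-steps {u} (inj₁ refl) = u , u , inj₁ refl , inj₁ refl , inj₁ refl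
  three-steps {v = v} (inj₂ (w , a , inj₁ refl)) = w , w , inj₂ a , inj₁ refl , inj₁ refl
  three-steps {v = v} (inj₂ (w , a , inj₂ (w' , b , inj₁ refl))) = w , w' , inj₂ a , inj₂ b , inj₁ refl
  three-steps {v = v} (inj₂ (w , a , inj₂ (w' , b , inj₂ (_ , c , refl)))) = w , w' , inj₂ a , inj₂ b , inj₂ c

  -- `target` is defined on all vertices so that every cop can follow it. By `maximal`, at most
  -- `length us` vertices of `C` lie near unmatched ones.
  record Matching (C us : List V) : Set where
    field
      target    : V → V
      reach     : ∀ v → Near v (target v)
      unmatched : List V
      used      : List V
      unmatched-size : length unmatched ≤ length us
      used-size      : length used ≤ length us
      covered   : ∀ {u} → u ∈ us → u ∈ unmatched ⊎ ∃[ c ] (c ∈ C × c ∈ used × target c ≡ u)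
      maximal   : ∀ {u c} → u ∈ unmatched → c ∈ C → Near c u → c ∈ used

  -- Greedy: a vertex stays unmatched only if all members of `C` near it are used, and this persists
  -- because `used` only grows.
  matching : (C us : List V) → Matching C us
  matching C [] = record
    { target = id ; reach = λ _ → near-refl ; unmatched = [] ; used = []
    ; unmatched-size = z≤n ; used-size = z≤n ; covered = λ () ; maximal = λ () }
  matching C (u ∷ us) with matching C us
  ... | M with any? (λ c → Near? c u ×-dec ¬? (any? (c ≟_) (Matching.used M))) C
  ...   | no none = record
    { target = target ; reach = reach ; unmatched = u ∷ unmatched ; used = used
    ; unmatched-size = s≤s unmatched-size ; used-size = m≤n⇒m≤1+n used-size
    ; covered = λ { (here refl) → inj₁ (here refl)
                  ; (there p) → [ inj₁ ∘ there , inj₂ ]′ (covered p) }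
    ; maximal = λ { (here refl) c∈C near → saturated c∈C near
                  ; (there p) → maximal p } }
    where
    open Matching M
    saturated : ∀ {c} → c ∈ C → Near c u → c ∈ used
    saturated {c} c∈C near with any? (c ≟_) used
    ... | yes p = p
    ... | no ¬p = contradiction (lose c∈C (near , ¬p)) none
  ...   | yes free = record
    { target = target' ; reach = reach' ; unmatched = unmatched ; used = c ∷ used
    ; unmatched-size = m≤n⇒m≤1+n unmatched-size ; used-size = s≤s used-size
    ; covered = covered' ; maximal = λ p q near → there (maximal p q near) }
    where
    open Matching M
    c = proj₁ (find free)
    c∈C = proj₁ (proj₂ (find free))
    c-near = proj₁ (proj₂ (proj₂ (find free)))
    c∉used = proj₂ (proj₂ (proj₂ (find free)))
    target' : V → V
    target' v with v ≟ c
    ... | yes _ = u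
    ... | no  _ = target v
    reach' : ∀ v → Near v (target' v)
    reach' v with v ≟ c
    ... | yes refl = c-near
    ... | no  _    = reach v
    target'-c : target' c ≡ u
    target'-c with c ≟ c
    ... | yes _ = refl
    ... | no ¬p = contradiction refl ¬p
    target'-other : ∀ {v} → v ∈ used → target' v ≡ target v
    target'-other {v} p with v ≟ c
    ... | yes refl = contradiction p c∉used
    ... | no  _    = refl
    covered' : ∀ {w} → w ∈ u ∷ us → w ∈ unmatched ⊎ ∃[ v ] (v ∈ C × v ∈ c ∷ used × target' v ≡ w)
    covered' (here refl) = inj₂ (c , c∈C , here refl , target'-c)
    covered' (there p) with covered p
    ... | inj₁ q = inj₁ q
    ... | inj₂ (v , v∈C , v∈used , eq) = inj₂ (v , v∈C , there v∈used , trans (target'-other v∈used) eq)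

  near-sym : ∀ {u v} → Near u v → Near v u
  near-sym (w , p , q) = w , step-sym q , step-sym p

  -- Captures and teams of cops

  capture : ∀ {k} {C : Fin k → V} {r} → ∃[ i ] Step G (C i) r → CopWinFrom G C r
  capture {C = C} {r} (i , s) = win C' legal (inj₁ (i , arrived))
    where
    -- All cops within one step of `r` jump there, the others stay.
    C' : _ → V
    C' j with Step? (C j) r
    ... | yes _ = r
    ... | no  _ = C j
    legal : ∀ j → Step G (C j) (C' j)
    legal j with Step? (C j) r
    ... | yes p = p
    ... | no  _ = inj₁ refl
    arrived : C' i ≡ r
    arrived with Step? (C i) r
    ... | yes _ = refl
    ... | no ¬p = contradiction s ¬p

  module _ {K : ℕ} where

    teams : (Fin 6 → Fin K → V) → Fin (6 * K) → V
    teams f = uncurry f ∘ remQuot K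

    advance : ∀ {r} (f g : Fin 6 → Fin K → V) → (∀ p i → Step G (f p i) (g p i)) →
      (∃[ p ] ∃[ i ] (g p i ≡ r)) ⊎ (∀ r' → Step G r r' → CopWinFrom G (teams g) r') →
      CopWinFrom G (teams f) r
    advance f g legal (inj₁ (p , i , eq)) = win (teams g) (λ j → uncurry legal (remQuot K j))
      (inj₁ (combine p i , trans (cong (uncurry g) (remQuot-combine p i)) eq))
    advance f g legal (inj₂ next) = win (teams g) (λ j → uncurry legal (remQuot K j)) (inj₂ next)

    capture-by : ∀ {r} (f : Fin 6 → Fin K → V) p → ∃[ i ] Step G (f p i) r → CopWinFrom G (teams f) r
    capture-by {r} f p (i , s) = capture (combine p i ,
      subst (λ j → Step G (uncurry f j) r) (sym (remQuot-combine p i)) s)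

  -- The five-move strategy

  -- The plan made when the robber is seen at `r`. If its next vertex lies in `R`, it is a target or
  -- in `escape`; two steps further on, the robber is beside a guard or in `residual`.
  record Response (K D : ℕ) (R : List V) (start : Fin K → V) (r : V) : Set where
    field
      target   : V → V
      reach    : ∀ v → Near v (target v)
      escape   : List V
      trap     : ∀ {u} → u ∈ R → Step G r u → u ∈ escape ⊎ ∃[ i ] (target (start i) ≡ u)
      guard    : Fin K → V
      residual : List V
      confine  : ∀ {u v} → u ∈ escape → Near u v → v ∈ residual ⊎ ∃[ i ] Step G (guard i) v
      thin     : ∀ v → length (filter (Step? v) residual) ≤ D

  module Strategy (diam : DiamAtMost G 3) (v₀ : V) {K D : ℕ} (D²≤K : D * D ≤ K)
    (R : List V) (sentry start : Fin K → V)
    (sentries : ∀ v → v ∈ R ⊎ ∃[ i ] Step G (sentry i) v)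
    (response : ∀ r → Response K D R start r) where

    open module Res r = Response (response r)

    leg₁ leg₂ : V → V
    leg₁ v = proj₁ (three-steps (diam v₀ v))
    leg₂ v = proj₁ (proj₂ (three-steps (diam v₀ v)))
    step₁ : ∀ v → Step G v₀ (leg₁ v)
    step₁ v = proj₁ (proj₂ (proj₂ (three-steps (diam v₀ v))))
    step₂ : ∀ v → Step G (leg₁ v) (leg₂ v)
    step₂ v = proj₁ (proj₂ (proj₂ (proj₂ (three-steps (diam v₀ v)))))
    step₃ : ∀ v → Step G (leg₂ v) v
    step₃ v = proj₂ (proj₂ (proj₂ (proj₂ (three-steps (diam v₀ v)))))

    stay : ∀ {v} → Step G v v
    stay = inj₁ refl

    -- Candidates for r₄: since r₁ lies in `escape r₀` and r₂ in `escape r₁`, evading the guards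
    -- puts r₃ in `residual r₀` and r₄ in `residual r₁`.
    haven : V → V → V → List V
    haven r₀ r₁ r₂ = concatMap (λ r₃ → filter (Step? r₃) (residual r₁)) (filter (Step? r₂) (residual r₀))

    haven-size : ∀ r₀ r₁ r₂ → length (haven r₀ r₁ r₂) ≤ K
    haven-size r₀ r₁ r₂ = ≤-trans
      (length-concatMap-≤ _ D (thin r₁) (filter (Step? r₂) (residual r₀)))
      (≤-trans (*-monoˡ-≤ D (thin r₀ r₂)) D²≤K)

    -- Teams: 0 sentries; 1 and 2 play the matchings for r₀ and r₁; 3 and 4 become the guards for
    -- r₀ and r₁; 5 occupies the haven. fᵢ is the position after the cops' i-th move.
    f₀ : Fin 6 → Fin K → V
    f₀ 0F = sentry
    f₀ 1F = start
    f₀ 2F = start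
    f₀ _  = λ _ → v₀

    f₁ : V → Fin 6 → Fin K → V
    f₁ r₀ 1F = λ i → proj₁ (reach r₀ (start i))
    f₁ r₀ 3F = leg₁ ∘ guard r₀
    f₁ r₀ p  = f₀ p

    f₂ : V → V → Fin 6 → Fin K → V
    f₂ r₀ r₁ 1F = target r₀ ∘ start
    f₂ r₀ r₁ 2F = λ i → proj₁ (reach r₁ (start i))
    f₂ r₀ r₁ 3F = leg₂ ∘ guard r₀
    f₂ r₀ r₁ 4F = leg₁ ∘ guard r₁
    f₂ r₀ r₁ p  = f₁ r₀ p

    f₃ : V → V → V → Fin 6 → Fin K → V
    f₃ r₀ r₁ r₂ 2F = target r₁ ∘ start
    f₃ r₀ r₁ r₂ 3F = guard r₀
    f₃ r₀ r₁ r₂ 4F = leg₂ ∘ guard r₁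
    f₃ r₀ r₁ r₂ 5F = leg₁ ∘ slot v₀ (haven r₀ r₁ r₂)
    f₃ r₀ r₁ r₂ p  = f₂ r₀ r₁ p

    f₄ : V → V → V → Fin 6 → Fin K → V
    f₄ r₀ r₁ r₂ 4F = guard r₁
    f₄ r₀ r₁ r₂ 5F = leg₂ ∘ slot v₀ (haven r₀ r₁ r₂)
    f₄ r₀ r₁ r₂ p  = f₃ r₀ r₁ r₂ p

    f₅ : V → V → V → Fin 6 → Fin K → V
    f₅ r₀ r₁ r₂ 5F = slot v₀ (haven r₀ r₁ r₂)
    f₅ r₀ r₁ r₂ p  = f₄ r₀ r₁ r₂ p

    -- Each round treats the cops' move of that number and calls the next one, so the last comes
    -- first. Here the guards for r₁ are in place, and team 5, which left when r₂ was seen, makes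
    -- its third move.
    round₅ : ∀ {r₀ r₁ r₂ r₃ r₄} → r₃ ∈ residual r₀ → r₂ ∈ escape r₁ →
      Step G r₂ r₃ → Step G r₃ r₄ → CopWinFrom G (teams (f₄ r₀ r₁ r₂)) r₄
    round₅ {r₀} {r₁} {r₂} {r₃} {r₄} r₃∈ r₂∈ s₃ s₄ with confine r₁ r₂∈ (r₃ , s₃ , s₄)
    ... | inj₂ near = capture-by (f₄ r₀ r₁ r₂) 4F near
    ... | inj₁ r₄∈ = advance (f₄ r₀ r₁ r₂) (f₅ r₀ r₁ r₂) legal (inj₁ (5F ,
            ∈-slot v₀ (∈-concatMap⁺ _ (lose (∈-filter⁺ _ r₃∈ s₃) (∈-filter⁺ _ r₄∈ s₄)))
              (haven-size r₀ r₁ r₂)))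
      where
      legal : ∀ p i → Step G (f₄ r₀ r₁ r₂ p i) (f₅ r₀ r₁ r₂ p i)
      legal 0F i = stay
      legal 1F i = stay
      legal 2F i = stay
      legal 3F i = stay
      legal 4F i = stay
      legal 5F i = step₃ _

    -- The guards for r₀ arrived with the third move, so they catch the robber unless r₃ is in
    -- `residual r₀`.
    round₄ : ∀ {r₀ r₁ r₂ r₃} → r₁ ∈ escape r₀ → r₂ ∈ escape r₁ →
      Step G r₁ r₂ → Step G r₂ r₃ → CopWinFrom G (teams (f₃ r₀ r₁ r₂)) r₃
    round₄ {r₀} {r₁} {r₂} {r₃} r₁∈ r₂∈ s₂ s₃ with confine r₀ r₁∈ (r₂ , s₂ , s₃)
    ... | inj₂ near = capture-by (f₃ r₀ r₁ r₂) 3F near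
    ... | inj₁ r₃∈ = advance (f₃ r₀ r₁ r₂) (f₄ r₀ r₁ r₂) legal (inj₂ λ r₄ s₄ → round₅ r₃∈ r₂∈ s₃ s₄)
      where
      legal : ∀ p i → Step G (f₃ r₀ r₁ r₂ p i) (f₄ r₀ r₁ r₂ p i)
      legal 0F i = stay
      legal 1F i = stay
      legal 2F i = stay
      legal 3F i = stay
      legal 4F i = step₃ _
      legal 5F i = step₂ _

    round₃ : ∀ {r₀ r₁ r₂} → r₁ ∈ escape r₀ → Step G r₁ r₂ → CopWinFrom G (teams (f₂ r₀ r₁)) r₂
    round₃ {r₀} {r₁} {r₂} r₁∈ s₂ with sentries r₂
    ... | inj₂ near = capture-by (f₂ r₀ r₁) 0F near
    ... | inj₁ r₂∈R = advance (f₂ r₀ r₁) (f₃ r₀ r₁ r₂) legal (outcome (trap r₁ r₂∈R s₂))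
      where
      legal : ∀ p i → Step G (f₂ r₀ r₁ p i) (f₃ r₀ r₁ r₂ p i)
      legal 0F i = stay
      legal 1F i = stay
      legal 2F i = proj₂ (proj₂ (reach r₁ (start i)))
      legal 3F i = step₃ _
      legal 4F i = step₂ _
      legal 5F i = step₁ _
      outcome : r₂ ∈ escape r₁ ⊎ _ → _
      outcome (inj₁ r₂∈)  = inj₂ λ r₃ s₃ → round₄ r₁∈ r₂∈ s₂ s₃
      outcome (inj₂ caught) = inj₁ (2F , caught)

    round₂ : ∀ {r₀ r₁} → Step G r₀ r₁ → CopWinFrom G (teams (f₁ r₀)) r₁
    round₂ {r₀} {r₁} s₁ with sentries r₁
    ... | inj₂ near = capture-by (f₁ r₀) 0F near
    ... | inj₁ r₁∈R = advance (f₁ r₀) (f₂ r₀ r₁) legal (outcome (trap r₀ r₁∈R s₁))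
      where
      legal : ∀ p i → Step G (f₁ r₀ p i) (f₂ r₀ r₁ p i)
      legal 0F i = stay
      legal 1F i = proj₂ (proj₂ (reach r₀ (start i)))
      legal 2F i = proj₁ (proj₂ (reach r₁ (start i)))
      legal 3F i = step₂ _
      legal 4F i = step₁ _
      legal 5F i = stay
      outcome : r₁ ∈ escape r₀ ⊎ _ → _
      outcome (inj₁ r₁∈)  = inj₂ λ r₂ s₂ → round₃ r₁∈ s₂
      outcome (inj₂ caught) = inj₁ (1F , caught)

    cops-win : CopsWin G (6 * K)
    cops-win = teams f₀ , λ r₀ → advance f₀ (f₁ r₀) (legal r₀) (inj₂ λ r₁ s₁ → round₂ s₁)
      where
      legal : ∀ r₀ p i → Step G (f₀ p i) (f₁ r₀ p i)
      legal r₀ 0F i = stay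
      legal r₀ 1F i = proj₁ (proj₂ (reach r₀ (start i)))
      legal r₀ 2F i = stay
      legal r₀ 3F i = step₁ _
      legal r₀ 4F i = stay
      legal r₀ 5F i = stay

  -- Responses from a hitting set

  -- Excluding D makes one hit suffice: with D ranging over all lists of length ≤ d, hitting every
  -- large N₂(U) ∖ D amounts to having more than d points in every N₂(U).
  Hit : List V × List V → V → Set
  Hit (U , D) v = Any (Near v) U × v ∉ D

  Hit? : ∀ p v → Dec (Hit p v)
  Hit? (U , D) v = any? (Near? v) U ×-dec ¬? (any? (v ≟_) D)

  module _ {K D d s : ℕ} (1≤D : 1 ≤ D) (fits : ∀ q → q * D ≤ s + d → q ≤ K) (v₀ : V)
    {R C : List V} (R-thin : ∀ v → length (filter (Step? v) R) ≤ d) (C≤K : length C ≤ K)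
    (C-hits : ∀ U W → length U ≤ d → length W ≤ d → s ≤ length (filter (Hit? (U , W)) (allFin n)) →
      ∃[ c ] (c ∈ C × Hit (U , W) c)) where

    respond : ∀ r → Response K D R (slot v₀ C) r
    respond r = record
      { target = target ; reach = reach ; escape = unmatched ; trap = trap
      ; guard = slot v₀ Q ; residual = Z ; confine = confine ; thin = proj₂ (proj₂ (proj₂ (proj₂ dom))) }
      where
      us = filter (Step? r) R
      open Matching (matching C us)
      trap : ∀ {u} → u ∈ R → Step G r u → u ∈ unmatched ⊎ ∃[ i ] (target (slot {K = K} v₀ C i) ≡ u)
      trap u∈R s with covered (∈-filter⁺ _ u∈R s)
      ... | inj₁ p = inj₁ p
      ... | inj₂ (c , c∈C , _ , eq) =
        let i , eq' = ∈-slot v₀ c∈C C≤K in inj₂ (i , trans (cong target eq') eq)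
      far : List V
      far = filter (Hit? (unmatched , used)) (allFin n)
      far≤s : length far ≤ s
      far≤s with s ≤? length far
      ... | no  s≰ = ≰⇒≥ s≰
      ... | yes s≤ with C-hits unmatched used (≤-trans unmatched-size (R-thin r)) (≤-trans used-size (R-thin r)) s≤
      ...   | c , c∈C , near , c∉used = let u , u∈ , p = find near in contradiction (maximal u∈ c∈C p) c∉used
      -- `far` omits the vertices in `used`, so they are put back before choosing guards.
      dom = dominate Step? D 1≤D (length (far ++ used)) (far ++ used) ≤-refl
      Q = proj₁ dom
      Z = proj₁ (proj₂ dom)
      Q≤K : length Q ≤ K
      Q≤K = fits (length Q) (≤-trans (proj₁ (proj₂ (proj₂ dom))) (≤-trans (≤-reflexive (length-++ far))
        (+-mono-≤ far≤s (≤-trans used-size (R-thin r)))))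
      second : ∀ {u v} → u ∈ unmatched → Near u v → v ∈ far ++ used
      second {u} {v} u∈ near with any? (v ≟_) used
      ... | yes p = ∈-++⁺ʳ far p
      ... | no ¬p = ∈-++⁺ˡ (∈-filter⁺ _ (∈-allFin v) (lose u∈ (near-sym near) , ¬p))
      confine : ∀ {u v} → u ∈ unmatched → Near u v → v ∈ Z ⊎ ∃[ i ] Step G (slot {K = K} v₀ Q i) v
      confine {v = v} u∈ near with proj₁ (proj₂ (proj₂ (proj₂ dom))) (second u∈ near)
      ... | inj₁ v∈Z = inj₁ v∈Z
      ... | inj₂ (q , q∈Q , st) =
        let i , eq = ∈-slot v₀ q∈Q Q≤K in inj₂ (i , subst (λ w → Step G w v) (sym eq) st)

-- Integer roots, logarithms and growth

-- A downward search from `N`; it provides both the seventh root and the binary logarithm of `n`.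
bracket : ∀ (f : ℕ → ℕ) n → f 0 ≤ n → ∀ N → n < f N → ∃[ x ] (f x ≤ n × n < f (suc x))
bracket f n base zero    h = contradiction base (<⇒≱ h)
bracket f n base (suc N) h with f N ≤? n
... | yes p = N , p , h
... | no ¬p = bracket f n base N (≰⇒> ¬p)

n<2^n : ∀ n → n < 2 ^ n
n<2^n zero    = s≤s z≤n
n<2^n (suc n) = +-mono-≤ (m^n>0 2 n) (≤-trans (n<2^n n) (≤-reflexive (sym (+-identityʳ _))))

-- With `z = suc (m / p)`, one has `suc m ≤ p * z` and `z ≤ 2 ^ (m / p)`. The choice of `M` gives
-- `c * p < z`, so the left side is below `(z * z) ^ q = z ^ p`.
exponential-beats-power : ∀ c q .{{_ : NonZero q}} → ∃[ M ] (∀ m → M ≤ m → (c * suc m) ^ q < 2 ^ m)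
exponential-beats-power c q = M , bound
  where
  p = q + q
  instance
    p≢0 : NonZero p
    p≢0 = >-nonZero (≤-trans (>-nonZero⁻¹ q) (m≤m+n q q))
  M = c * p * p
  bound : ∀ m → M ≤ m → (c * suc m) ^ q < 2 ^ m
  bound m M≤m = begin-strict
    (c * suc m) ^ q        ≤⟨ ^-monoˡ-≤ q (*-monoʳ-≤ c m<) ⟩
    (c * (p * z)) ^ q      ≡⟨ cong (_^ q) (*-assoc c p z) ⟨
    (c * p * z) ^ q        <⟨ ^-monoˡ-< q (*-monoˡ-< z (s≤s (≤-trans (≤-reflexive (sym (m*n/n≡m (c * p) p))) (/-monoˡ-≤ p M≤m)))) ⟩
    (z * z) ^ q            ≡⟨ ^-distribʳ-* z z q ⟩
    z ^ q * z ^ q          ≡⟨ ^-distribˡ-+-* z q q ⟨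
    z ^ p                  ≤⟨ ^-monoˡ-≤ p (n<2^n (m / p)) ⟩
    (2 ^ (m / p)) ^ p      ≡⟨ ^-*-assoc 2 (m / p) p ⟩
    2 ^ (m / p * p)        ≤⟨ ^-monoʳ-≤ 2 (m/n*n≤m m p) ⟩
    2 ^ m                  ∎
    where
    open ≤-Reasoning
    z = suc (m / p)
    m< : suc m ≤ p * z
    m< = begin
      suc m                          ≡⟨ cong suc (m≡m%n+[m/n]*n m p) ⟩
      suc (m % p) + m / p * p        ≤⟨ +-monoˡ-≤ (m / p * p) (m%n<n m p) ⟩
      z * p                          ≡⟨ *-comm z p ⟩
      p * z                          ∎

-- Choice of parameters

-- 384 = 128 · 3: the hitting set has size 128 x · 3 x³ ℓ, where 128 x · x⁶ ≥ n, since
-- n < (1 + x)⁷ ≤ 128 x⁷, and 2 ^ (3 x³ ℓ) exceeds the number of pairs (U , D).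
team-size : ℕ → ℕ → ℕ
team-size x ℓ = 384 * (x ^ 4 * ℓ)

module _ (m x ℓ : ℕ) .{{_ : NonZero x}} .{{_ : NonZero ℓ}}
  (x^7≤n : x ^ 7 ≤ suc m) (n<[1+x]^7 : suc m < suc x ^ 7) (n<2^ℓ : suc m < 2 ^ ℓ)
  (G : Graph (suc m)) (diam : DiamAtMost G 3) where

  open Play G
  open ≤-Reasoning

  private
    n K d s t : ℕ
    n = suc m
    K = team-size x ℓ
    -- `d` bounds the robber's unguarded options, `s` the size of `far`; a pick misses at most a
    -- fraction `t / n` on average.
    d = x ^ 3
    s = x ^ 6
    t = n ∸ s

    s+t≡n : s + t ≡ n
    s+t≡n = m+[n∸m]≡n (≤-trans (^-monoʳ-≤ x (n≤1+n 6)) x^7≤n)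

    n≤128x^7 : n ≤ 128 * x ^ 7
    n≤128x^7 = begin
      n              <⟨ n<[1+x]^7 ⟩
      suc x ^ 7      ≤⟨ ^-monoˡ-≤ 7 (+-mono-≤ (>-nonZero⁻¹ x) (≤-reflexive (sym (+-identityʳ x)))) ⟩
      (2 * x) ^ 7    ≡⟨ ^-distribʳ-* 2 x 7 ⟩
      128 * x ^ 7    ∎

    ≤K : ∀ c → c ≤ 384 → c * x ^ 4 ≤ K
    ≤K c c≤ = *-mono-≤ c≤ (m≤m*n (x ^ 4) ℓ)

    few-sentries : ∀ q → q * x ^ 3 ≤ n → q ≤ K
    few-sentries q h = ≤-trans (*-cancelʳ-≤ q (128 * x ^ 4) (x ^ 3) {{m^n≢0 x 3}} (begin
      q * x ^ 3              ≤⟨ h ⟩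
      n                      ≤⟨ n≤128x^7 ⟩
      128 * x ^ 7            ≡⟨ cong (128 *_) (^-distribˡ-+-* x 4 3) ⟩
      128 * (x ^ 4 * x ^ 3)  ≡⟨ *-assoc 128 (x ^ 4) (x ^ 3) ⟨
      128 * x ^ 4 * x ^ 3    ∎)) (≤K 128 (m≤m+n 128 256))

    -- There are at most `2 * x ^ 6` vertices to guard, and each guard accounts for `x ^ 2` of them.
    few-guards : ∀ q → q * x ^ 2 ≤ s + d → q ≤ K
    few-guards q h = ≤-trans (*-cancelʳ-≤ q (2 * x ^ 4) (x ^ 2) {{m^n≢0 x 2}} (begin
      q * x ^ 2            ≤⟨ h ⟩
      s + d                ≤⟨ +-monoʳ-≤ s (^-monoʳ-≤ x (m≤m+n 3 3)) ⟩
      s + s                ≡⟨ cong (s +_) (+-identityʳ s) ⟨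
      2 * x ^ 6            ≡⟨ cong (2 *_) (^-distribˡ-+-* x 4 2) ⟩
      2 * (x ^ 4 * x ^ 2)  ≡⟨ *-assoc 2 (x ^ 4) (x ^ 2) ⟨
      2 * x ^ 4 * x ^ 2    ∎)) (≤K 2 (m≤m+n 2 382))

    g b : ℕ
    g = 128 * x
    b = 3 * (x ^ 3 * ℓ)

    gb≡K : g * b ≡ K
    gb≡K = rearrange x (x ^ 3) ℓ
      where
      rearrange : ∀ x p ℓ → 128 * x * (3 * (p * ℓ)) ≡ 384 * (x * p * ℓ)
      rearrange = solve-∀

    pairs : List (List V × List V)
    pairs = cartesianProduct (lists (allFin n) d) (lists (allFin n) d)

    spread? : ∀ p → Dec (s ≤ length (filter (Hit? p) (allFin n)))
    spread? p = s ≤? length (filter (Hit? p) (allFin n))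

    length-lists-allFin : length (lists (allFin n) d) ≤ 2 ^ (d * ℓ)
    length-lists-allFin = begin
      length (lists (allFin n) d)   ≤⟨ length-lists (allFin n) d ⟩
      suc (length (allFin n)) ^ d   ≡⟨ cong (λ k → suc k ^ d) (length-allFin n) ⟩
      -- The extra letter is absorbed by the strictness of `n < 2 ^ ℓ`.
      suc n ^ d                     ≤⟨ ^-monoˡ-≤ d n<2^ℓ ⟩
      (2 ^ ℓ) ^ d                   ≡⟨ ^-*-assoc 2 ℓ d ⟩
      2 ^ (ℓ * d)                   ≡⟨ cong (2 ^_) (*-comm ℓ d) ⟩
      2 ^ (d * ℓ)                   ∎

    few-pairs : length (filter spread? pairs) < 2 ^ b
    few-pairs = begin-strict
      length (filter spread? pairs)        ≤⟨ length-filter spread? pairs ⟩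
      length pairs                         ≡⟨ length-cartesianProductWith _,_ (lists (allFin n) d) _ ⟩
      length (lists (allFin n) d) * length (lists (allFin n) d)
                                           ≤⟨ *-mono-≤ length-lists-allFin length-lists-allFin ⟩
      2 ^ (d * ℓ) * 2 ^ (d * ℓ)            ≡⟨ ^-distribˡ-+-* 2 (d * ℓ) (d * ℓ) ⟨
      -- Two copies of `d * ℓ` count the pairs; the third one in `b` makes the bound strict.
      2 ^ (d * ℓ + d * ℓ)                  <⟨ ^-monoʳ-< 2 (s≤s (s≤s z≤n)) (+-monoʳ-< (d * ℓ)
                                                (m<m+n (d * ℓ) (≤-trans dℓ>0 (m≤m+n (d * ℓ) 0)))) ⟩
      2 ^ b                                ∎
      where
      dℓ>0 : 0 < d * ℓ
      dℓ>0 = *-mono-≤ (m^n>0 x 3) (>-nonZero⁻¹ ℓ)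

    hitters : ∃[ C ] (length C ≤ g * b × (∀ {p} → p ∈ filter spread? pairs → ∃[ v ] (v ∈ C × Hit p v)))
    hitters = hitting-set Hit? s t s+t≡n (g * b) (filter spread? pairs)
      (proj₂ ∘ ∈-filter⁻ spread? {xs = pairs})
      (subst (λ k → length (filter spread? pairs) * t ^ (g * b) < k ^ (g * b)) s+t≡n
        (decay s t g b _ (m^n>0 x 6) s+t≤gs few-pairs))
      where
      s+t≤gs : s + t ≤ g * s
      s+t≤gs = begin
        s + t          ≡⟨ s+t≡n ⟩
        n              ≤⟨ n≤128x^7 ⟩
        128 * x ^ 7    ≡⟨ *-assoc 128 x (x ^ 6) ⟨
        g * s          ∎

    C = proj₁ hitters

    C-hits : ∀ U W → length U ≤ d → length W ≤ d → s ≤ length (filter (Hit? (U , W)) (allFin n)) →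
      ∃[ c ] (c ∈ C × Hit (U , W) c)
    C-hits U W U≤ W≤ big = proj₂ (proj₂ hitters) (∈-filter⁺ spread?
      (∈-cartesianProduct⁺ (∈-lists ∈-allFin d U U≤) (∈-lists ∈-allFin d W W≤)) big)

    dom = dominate Step? d (m^n>0 x 3) n (allFin n) (≤-reflexive (length-allFin n))
    Q R : List V
    Q = proj₁ dom
    R = proj₁ (proj₂ dom)

    Q≤K : length Q ≤ K
    Q≤K = few-sentries (length Q) (≤-trans (proj₁ (proj₂ (proj₂ dom))) (≤-reflexive (length-allFin n)))

    sentries : ∀ v → v ∈ R ⊎ ∃[ i ] Step G (slot {K = K} zero Q i) v
    sentries v with proj₁ (proj₂ (proj₂ (proj₂ dom))) (∈-allFin v)
    ... | inj₁ v∈R = inj₁ v∈R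
    ... | inj₂ (q , q∈Q , st) =
      let i , eq = ∈-slot zero q∈Q Q≤K in inj₂ (i , subst (λ w → Step G w v) (sym eq) st)

    x²x²≤K : x ^ 2 * x ^ 2 ≤ K
    x²x²≤K = begin
      x ^ 2 * x ^ 2  ≡⟨ ^-distribˡ-+-* x 2 2 ⟨
      x ^ 4          ≡⟨ *-identityˡ (x ^ 4) ⟨
      1 * x ^ 4      ≤⟨ ≤K 1 (s≤s z≤n) ⟩
      K              ∎

  six-teams-win : CopsWin G (6 * team-size x ℓ)
  six-teams-win = Strategy.cops-win diam zero x²x²≤K R (slot zero Q) (slot zero C) sentries
    (respond (m^n>0 x 2) few-guards zero (proj₂ (proj₂ (proj₂ (proj₂ dom))))
      (≤-trans (proj₁ (proj₂ hitters)) (≤-reflexive gb≡K)) C-hits)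

-- The exponent 4/7

-- The factor `x ^ 4` is at most n^(4/7), and `small` keeps the logarithmic factor `2304 * ℓ` below
-- n^(1/q).
six-teams-size : ∀ n x ℓ q → x ^ 7 ≤ n → (2304 * ℓ) ^ q < n →
  (6 * team-size x ℓ) ^ (7 * q) < n ^ (4 * q + 7)
six-teams-size n x ℓ q x^7≤n small = begin-strict
  (6 * (384 * (x ^ 4 * ℓ))) ^ (7 * q)          ≡⟨ cong (_^ (7 * q)) (rearrange (x ^ 4) ℓ) ⟩
  (x ^ 4 * (2304 * ℓ)) ^ (7 * q)               ≡⟨ ^-distribʳ-* (x ^ 4) (2304 * ℓ) (7 * q) ⟩
  (x ^ 4) ^ (7 * q) * (2304 * ℓ) ^ (7 * q)     ≡⟨ cong₂ _*_ (exchange x) second ⟩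
  (x ^ 7) ^ (4 * q) * ((2304 * ℓ) ^ q) ^ 7     ≤⟨ *-monoˡ-≤ _ (^-monoˡ-≤ (4 * q) x^7≤n) ⟩
  n ^ (4 * q) * ((2304 * ℓ) ^ q) ^ 7           <⟨ *-monoʳ-< (n ^ (4 * q)) {{m^n≢0 n (4 * q) {{n≢0}}}} (^-monoˡ-< 7 small) ⟩
  n ^ (4 * q) * n ^ 7                          ≡⟨ ^-distribˡ-+-* n (4 * q) 7 ⟨
  n ^ (4 * q + 7)                              ∎
  where
  open ≤-Reasoning
  n≢0 : NonZero n
  n≢0 = >-nonZero (≤-trans (s≤s z≤n) small)
  rearrange : ∀ p ℓ → 6 * (384 * (p * ℓ)) ≡ p * (2304 * ℓ)
  rearrange = solve-∀
  exponents : ∀ q → 4 * (7 * q) ≡ 7 * (4 * q)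
  exponents = solve-∀
  exchange : ∀ x → (x ^ 4) ^ (7 * q) ≡ (x ^ 7) ^ (4 * q)
  exchange x = trans (^-*-assoc x 4 (7 * q)) (trans (cong (x ^_) (exponents q)) (sym (^-*-assoc x 7 (4 * q))))
  second : (2304 * ℓ) ^ (7 * q) ≡ ((2304 * ℓ) ^ q) ^ 7
  second = trans (cong ((2304 * ℓ) ^_) (*-comm 7 q)) (sym (^-*-assoc (2304 * ℓ) q 7))

-- The inequality says k < n^(4/7 + 1/q). As `q` is arbitrary and `N` depends only on `q`, this is
-- the o(1) in the exponent.
theorem7 : (q : ℕ) → 1 ≤ q →
    ∃[ N ] (∀ (n : ℕ) → N ≤ n → (G : Graph n) → DiamAtMost G 3 →
    ∃[ k ] ((k ^ (7 * q) < n ^ (4 * q + 7)) × CopsWin G k))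
theorem7 q 1≤q = 2 ^ M , win-large
  where
  growth = exponential-beats-power 2304 q {{>-nonZero 1≤q}}
  M = proj₁ growth
  win-large : ∀ n → 2 ^ M ≤ n → (G : Graph n) → DiamAtMost G 3 →
    ∃[ k ] ((k ^ (7 * q) < n ^ (4 * q + 7)) × CopsWin G k)
  win-large zero    N≤n = contradiction (m^n>0 2 M) (≤⇒≯ N≤n)
  win-large (suc m) N≤n G diam with bracket (_^ 7) (suc m) z≤n (2 + m) (m<m^7 (suc m))
                                | bracket (2 ^_) (suc m) (s≤s z≤n) (suc m) (n<2^n (suc m))
    where
    m<m^7 : ∀ m → m < suc m ^ 7
    m<m^7 m = ≤-trans (≤-reflexive (sym (*-identityʳ (suc m)))) (^-monoʳ-≤ (suc m) (s≤s (z≤n {6})))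
  ... | zero , _ , n<1 | _ = contradiction n<1 (<⇒≱ (s≤s (s≤s z≤n)))
  -- Here ℓ is `suc e`. From `n ≥ 2 ^ M` follows `M ≤ e`, so `growth` bounds `(2304 * suc e) ^ q` by
  -- `2 ^ e ≤ n`.
  ... | x@(suc _) , x^7≤n , n<[1+x]^7 | e , 2^e≤n , n<2^ℓ = 6 * team-size x (suc e) ,
    six-teams-size (suc m) x (suc e) q x^7≤n (≤-trans (proj₂ growth e M≤e) 2^e≤n) ,
    six-teams-win m x (suc e) x^7≤n n<[1+x]^7 n<2^ℓ G diam
    where
    M≤e : M ≤ e
    M≤e = ≮⇒≥ λ e<M → <⇒≱ n<2^ℓ (≤-trans (^-monoʳ-≤ 2 e<M) N≤n)
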